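{- The function $$(1^n\,0\,1^r\,0\,1^{a_1}\,0\,1^{a_2}\,0\,\cdots\,0\,1^{a_k})\ \mapsto\ \mathrm{coeff}_{q^r}\binom{n}{a_1,a_2,\ldots,a_k}_{\!q},$$ giving the coefficient at $q^r$ in the $q$-multinomial coefficient, is in $\#\mathsf{L}$.
   Context: Define the $q$-integer $(n)_q=(1-q^n)/(1-q)$, the $q$-factorial $(n)_q!=(n)_q(n-1)_q\cdots(1)_q$, the $q$-binomial $\binom{n+m}{n}_{q}=\frac{(n+m)_q!}{(n)_q!\,(m)_q!}$, and the $q$-multinomial $\binom{n}{a_1,\ldots,a_k}_{q}=\binom{n}{a_1}_{q}\binom{n-a_1}{a_2}_{q}\binom{n-a_1-a_2}{a_3}_q\cdots$, for non-negative integers $a_1,\dots,a_k$ with $a_1+\cdots+a_k=n$. It is a polynomial in $q$, and $\mathrm{coeff}_{q^r}$ extracts the coefficient of $q^r$. The number $k$ is part of the input (not fixed). The alphabet is $\Sigma=\{0,1\}$; $1^a$ is the string of $a$ ones and juxtaposition is concatenation. A function given only on strings of a displayed form is extended by $0$ to all other strings. $\#\mathsf{L}$ is the class of functions $f:\Sigma^*\to\mathbb{N}_0$ such that $f(x)$ is the number of accepting computation paths on input $x$ of a fixed nondeterministic Turing machine with read-only input tape that uses $O(\log|x|)$ work space and halts on every computation path. Equivalently: there are a polynomial $p$ and a deterministic $O(\log|x|)$-space Turing machine $M$ with an additional read-once, left-to-right witness tape such that $f(x)=\#\{w\in\Sigma^{p(|x|)}\mid M(x,w)=\mathsf{yes}\}$.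 -}

module Defs where

open import Data.Bool.Base using (Bool; true; false; if_then_else_)
open import Data.Fin.Base using (Fin)
open import Data.Integer.Base as ℤ using (ℤ; +_; 0ℤ; 1ℤ; _+_; _*_; _-_)
import Data.Integer.Properties as ℤ
open import Data.Integer.Tactic.RingSolver using (solve-∀)
open import Data.List.Base using (List; []; _∷_; _++_; length; replicate; concatMap)
open import Data.List.Membership.Propositional using (_∈_)
open import Data.List.Relation.Unary.Unique.Propositional using (Unique)
open import Data.Nat.Base as ℕ using (ℕ; zero; suc; _∸_; _⊓_; _≤_; _≡ᵇ_)
open import Data.Nat.ListAction using (sum)
open import Data.Nat.Logarithm using (⌊log₂_⌋)
open import Data.Product.Base using (Σ; ∃; ∃₂; _×_; _,_)
open import Data.Vec.Base as Vec using (Vec)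
open import Function.Base using (flip)
open import Function.Bundles using (_↔_)
open import Induction.WellFounded using (Acc)
open import Relation.Binary.Construct.Closure.ReflexiveTransitive using (Star)
open import Relation.Binary.PropositionalEquality

------------------------------------------------------------------------
-- q-multinomial coefficients
--
-- All quotients are taken in ℤ[[q]], which contains ℤ[q]: every
-- denominator below has constant term 1 and hence is invertible there.

Series : Set
Series = ℕ → ℤ

coeff : ℕ → Series → ℤ
coeff r f = f r

shift : Series → Series
shift f i = f (suc i)

oneₛ : Series
oneₛ i = if i ≡ᵇ 0 then 1ℤ else 0ℤ

q^_ : ℕ → Series
(q^ n) i = if i ≡ᵇ n then 1ℤ else 0ℤ

infixl 6 _-ₛ_
infixl 7 _*ₛ_ _/ₛ_

_-ₛ_ : Series → Series → Series
(f -ₛ g) i = f i - g i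

-- Cauchy product, from  f g = f₀ g + q (shift f) g.
_*ₛ_ : Series → Series → Series
(f *ₛ g) zero    = f 0 * g 0
(f *ₛ g) (suc n) = f 0 * g (suc n) + (shift f *ₛ g) n

-- Long division by a series with constant term 1, from
--   f / g = f₀ + q ((shift f - f₀ shift g) / g).
-- The result is meaningless when g 0 ≢ 1; see /ₛ-correct.
_/ₛ_ : Series → Series → Series
(f /ₛ g) zero    = f 0
(f /ₛ g) (suc n) = ((λ i → f (suc i) - f 0 * g (suc i)) /ₛ g) n

/ₛ-correct : ∀ f g → g 0 ≡ 1ℤ → (f /ₛ g) *ₛ g ≗ f
/ₛ-correct f g g₀ zero    = trans (cong (f 0 *_) g₀) (ℤ.*-identityʳ (f 0))
/ₛ-correct f g g₀ (suc n) =
  trans (cong (λ z → f 0 * g (suc n) + z)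
              (/ₛ-correct (λ i → f (suc i) - f 0 * g (suc i)) g g₀ n))
        (cancel (f 0 * g (suc n)) (f (suc n)))
  where
  cancel : ∀ x y → x + (y - x) ≡ y
  cancel = solve-∀

qInteger : ℕ → Series
qInteger n = (oneₛ -ₛ q^ n) /ₛ (oneₛ -ₛ q^ 1)

qFactorial : ℕ → Series
qFactorial zero    = oneₛ
qFactorial (suc n) = qInteger (suc n) *ₛ qFactorial n

-- Only used for k ≤ n.
qBinomial : ℕ → ℕ → Series
qBinomial n k = qFactorial n /ₛ (qFactorial k *ₛ qFactorial (n ∸ k))

-- Only used when the entries of the list sum to n.
qMultinomial : ℕ → List ℕ → Series
qMultinomial n []       = oneₛ
qMultinomial n (a ∷ as) = qBinomial n a *ₛ qMultinomial (n ∸ a) as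

qFactorial₀ : ∀ n → qFactorial n 0 ≡ 1ℤ
qFactorial₀ zero    = refl
qFactorial₀ (suc n) = trans (ℤ.*-identityˡ _) (qFactorial₀ n)

qInteger-correct : ∀ n → qInteger n *ₛ (oneₛ -ₛ q^ 1) ≗ oneₛ -ₛ q^ n
qInteger-correct n = /ₛ-correct _ _ refl

qBinomial-correct : ∀ n k →
  qBinomial n k *ₛ (qFactorial k *ₛ qFactorial (n ∸ k)) ≗ qFactorial n
qBinomial-correct n k =
  /ₛ-correct _ _ (cong₂ _*_ (qFactorial₀ k) (qFactorial₀ (n ∸ k)))

------------------------------------------------------------------------
-- The function on strings; false and true are the symbols 0 and 1.

ones : ℕ → List Bool
ones a = replicate a true

encode : ℕ → ℕ → List ℕ → List Bool
encode n r as = ones n ++ false ∷ ones r ++ concatMap (λ a → false ∷ ones a) as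

-- These conditions determine f, since encode is injective.  The list of
-- lower entries is nonempty.
record IsQMultinomialCoeff (f : List Bool → ℕ) : Set where
  field
    on-encodings : ∀ n r a as → sum (a ∷ as) ≡ n →
      + f (encode n r (a ∷ as)) ≡ coeff r (qMultinomial n (a ∷ as))
    elsewhere : ∀ x →
      (∀ n r a as → sum (a ∷ as) ≡ n → x ≢ encode n r (a ∷ as)) →
      f x ≡ 0

------------------------------------------------------------------------
-- Nondeterministic Turing machines with a read-only input tape

Finite : Set → Set
Finite A = ∃ λ n → A ↔ Fin n

data Move : Set where
  left stay right : Move

data InputSymbol : Set where
  ⊢ ⊣ : InputSymbol
  bit : Bool → InputSymbol

-- The input tape holds ⊢ x ⊣, with ⊢ in cell 0.
scan : List Bool → ℕ → InputSymbol
scan x       zero          = ⊢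
scan []      (suc i)       = ⊣
scan (b ∷ x) (suc zero)    = bit b
scan (b ∷ x) (suc (suc i)) = scan x (suc i)

-- The input head never leaves ⊢ x ⊣: a move off either end has no effect.
moveInput : List Bool → Move → ℕ → ℕ
moveInput x left  i = i ∸ 1
moveInput x stay  i = i
moveInput x right i = suc i ⊓ suc (length x)

-- The part of a two-way infinite work tape visited so far; the cells to the
-- left of the head are listed from the head outwards.
record Tape (Γ : Set) : Set where
  constructor tape
  field
    before : List Γ
    head   : Γ
    after  : List Γ

open Tape public

visited : ∀ {Γ} → Tape Γ → ℕ
visited t = length (before t) ℕ.+ 1 ℕ.+ length (after t)

moveTape : ∀ {Γ} → Γ → Move → Tape Γ → Tape Γ
moveTape blank left  (tape []       c rs)       = tape [] blank (c ∷ rs)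
moveTape blank left  (tape (l ∷ ls) c rs)       = tape ls l (c ∷ rs)
moveTape blank stay  t                          = t
moveTape blank right (tape ls       c [])       = tape (c ∷ ls) blank []
moveTape blank right (tape ls       c (r ∷ rs)) = tape (c ∷ ls) r rs

writeTape : ∀ {Γ} → Γ → Tape Γ → Tape Γ
writeTape c t = record t { head = c }

record Transition (State Γ : Set) (k : ℕ) : Set where
  constructor transition
  field
    next      : State
    inputMove : Move
    actions   : Vec (Γ × Move) k

record Machine : Set₁ where
  field
    State        : Set
    finiteState  : Finite State
    Γ            : Set
    finiteΓ      : Finite Γ
    blank        : Γ
    workTapes    : ℕ
    start        : State
    accepting    : State → Bool
    δ            : State → InputSymbol → Vec Γ workTapes →
                   List (Transition State Γ workTapes)
    -- The list represents a set, so no transition is counted twice.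
    δ-unique     : ∀ s i w → Unique (δ s i w)

module Run (M : Machine) (x : List Bool) where
  open Machine M

  record Config : Set where
    constructor config
    field
      state    : State
      inputPos : ℕ
      tapes    : Vec (Tape Γ) workTapes

  open Config public

  initial : Config
  initial = config start 0 (Vec.replicate workTapes (tape [] blank []))

  transitions : Config → List (Transition State Γ workTapes)
  transitions c = δ (state c) (scan x (inputPos c)) (Vec.map head (tapes c))

  act : Γ × Move → Tape Γ → Tape Γ
  act (s , m) t = moveTape blank m (writeTape s t)

  apply : Transition State Γ workTapes → Config → Config
  apply (transition s m as) c =
    config s (moveInput x m (inputPos c)) (Vec.zipWith act as (tapes c))

  data _⟶_ (c : Config) : Config → Set where
    fire : ∀ {t} → t ∈ transitions c → c ⟶ apply t c

  -- A machine halts exactly when no transition applies.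
  data AcceptingPath (c : Config) : Set where
    accept : transitions c ≡ [] → accepting (state c) ≡ true → AcceptingPath c
    step   : ∀ {c′} → c ⟶ c′ → AcceptingPath c′ → AcceptingPath c

  HaltsOnEveryPath : Set
  HaltsOnEveryPath = Acc (flip _⟶_) initial

  space : Config → ℕ
  space c = Vec.sum (Vec.map visited (tapes c))

  UsesSpaceAtMost : ℕ → Set
  UsesSpaceAtMost s = ∀ {c} → Star _⟶_ initial c → space c ≤ s

LogSpace : Machine → Set
LogSpace M = ∃₂ λ C n₀ → ∀ x → n₀ ≤ length x →
  Run.UsesSpaceAtMost M x (C ℕ.* ⌊log₂ length x ⌋)

infix 4 _∈#L

_∈#L : (List Bool → ℕ) → Set₁
f ∈#L = Σ Machine λ M →
  LogSpace M ×
  (∀ x → Run.HaltsOnEveryPath M x) ×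
  (∀ x → Run.AcceptingPath M x (Run.initial M x) ↔ Fin (f x))

{-# OPTIONS --safe #-}
module Submission where

-- The Gaussian binomial coefficient of j + m over j is the generating
-- function, by inversions, of the words with j ones and m zeros: removing
-- the first letter gives
--   [j, m] = [j - 1, m] + q^j [j, m - 1],
-- where a first zero is inverted with each of the j ones after it.  This
-- recurrence defines "gaussian", and "gaussian-factorial" shows by the
-- identity [a] + q^a [b] = [a + b] for q-integers that it satisfies the
-- factorial formula; division by series with constant term 1 being unique,
-- it is the q-binomial coefficient ("gaussian≗qBinomial").  Hence
-- the coefficient of q^r in a q-multinomial coefficient counts the
-- sequences of words, one for each lower entry, that have r inversions in
-- total: the word of the entry a has a ones, and as many zeros as remain
-- for the later entries.
--
-- A nondeterministic machine guesses these words letter by letter.  It need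
-- not store them: it keeps the number of ones and zeros still to be placed,
-- and a budget of inversions, initially r, that every zero diminishes by the
-- number of remaining ones.  Distinct guesses are distinct paths, and a path
-- accepts exactly when all letters and the budget are used up.  "count" is
-- the resulting number of paths as a recursive function of the input, and
-- "count-isQMultinomialCoeff" identifies it.
--
-- The machine is written as a program with five counters, none of which ever
-- exceeds the length of the input.  Programs with counters compile to Turing
-- machines that keep each counter in binary on a work tape of its own; the
-- relation "Counts" describes the behaviour of a program, and "simulate"
-- transfers it to the machine, with termination, the number of accepting
-- paths and the space used all established by the same induction.
open import Defs
open import Data.Product.Base using (∃; _×_)

open import Algebra.Bundles using (CommutativeRing)
import Algebra.Construct.Pointwise as Functions
import Algebra.Properties.Ring as RingProperties
import Algebra.Solver.Ring.NaturalCoefficients.Default as Solver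
open import Data.Bool.Base using (Bool; true; false; if_then_else_)
open import Data.Empty using (⊥-elim)
open import Data.Fin using (#_)
open import Data.Fin.Base using (Fin; zero; suc)
open import Data.Fin.Properties using (+↔⊎; *↔×; 0↔⊥; 1↔⊤)
open import Data.Integer.Base as ℤ using (ℤ; 0ℤ; 1ℤ)
import Data.Integer.Properties as ℤ
open import Data.Integer.Tactic.RingSolver using (solve-∀)
open import Data.List.Base as List
  using (List; []; _∷_; [_]; _++_; _∷ʳ_; _ʳ++_; concatMap; drop; length; map)
open import Data.List.Membership.Propositional using (_∈_)
open import Data.List.Membership.Propositional.Properties.Core using (Any↔)
open import Data.List.Properties using (length-++; length-map; ++-assoc; ++-identityʳ)
import Data.List.Relation.Unary.All as All
import Data.List.Relation.Unary.AllPairs as AllPairs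
open import Data.List.Relation.Unary.Any using (Any; here; there)
open import Data.List.Relation.Unary.Any.Properties using (∷↔; ⊥↔Any[])
open import Data.List.Relation.Unary.Unique.Propositional using (Unique)
open import Data.Maybe.Base using (Maybe; just; nothing)
open import Data.Nat.Base
  using (ℕ; zero; suc; _+_; _*_; _∸_; _^_; _⊓_; _≤_; _<_; z≤n; s≤s)
open import Data.Nat.ListAction using (sum)
open import Data.Nat.Logarithm using (⌊log₂_⌋; ⌊log₂⌋-mono-≤; ⌊log₂[2^n]⌋≡n)
open import Data.Nat.Properties hiding (≡-irrelevant)
open import Data.Product.Base using (∃₂; _,_; proj₁; proj₂)
open import Data.Product.Function.NonDependent.Propositional using (_×-↔_)
open import Data.Sum.Base using (_⊎_; inj₁; inj₂)
open import Data.Sum.Function.Propositional using (_⊎-↔_)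
open import Data.Vec.Base as Vec using (Vec; []; _∷_; lookup; _[_]≔_)
open import Data.Vec.Properties
  using ([]≔-lookup; []≔-idempotent; lookup∘update; lookup-map)
open import Data.Vec.Relation.Binary.Pointwise.Inductive as Pointwise
  using (Pointwise; []; _∷_)
open import Data.Vec.Relation.Unary.All as VecAll using ([]; _∷_)
open import Function.Base using (flip; id; const; _∘_)
open import Function.Bundles using (_↔_; mk↔ₛ′)
open import Function.Construct.Composition using (_↔-∘_)
open import Function.Construct.Identity using (↔-id)
open import Function.Construct.Symmetry using (↔-sym)
open import Induction.WellFounded using (Acc; acc)
open import Level using (0ℓ)
open import Relation.Binary.Construct.Closure.ReflexiveTransitive using (Star; ε; _◅_)
open import Relation.Binary.PropositionalEquality hiding ([_]; J)
open import Relation.Binary.PropositionalEquality.WithK using (≡-irrelevant)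
import Relation.Binary.Reasoning.Setoid as SetoidReasoning
open import Relation.Nullary.Negation using (¬_)

-- The ring of power series

infixl 6 _+ₛ_

_+ₛ_ : Series → Series → Series
(f +ₛ g) i = f i ℤ.+ g i

-ₛ_ : Series → Series
(-ₛ f) i = ℤ.- f i

zeroₛ : Series
zeroₛ i = 0ℤ

*ₛ-cong : ∀ {f f′ g g′} → f ≗ f′ → g ≗ g′ → f *ₛ g ≗ f′ *ₛ g′
*ₛ-cong p q zero    = cong₂ ℤ._*_ (p 0) (q 0)
*ₛ-cong p q (suc n) = cong₂ ℤ._+_ (cong₂ ℤ._*_ (p 0) (q (suc n)))
                                  (*ₛ-cong (λ i → p (suc i)) q n)

*ₛ-zeroˡ : ∀ f → zeroₛ *ₛ f ≗ zeroₛ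
*ₛ-zeroˡ f zero    = refl
*ₛ-zeroˡ f (suc n) = trans (ℤ.+-identityˡ _) (*ₛ-zeroˡ f n)

*ₛ-identityˡ : ∀ f → oneₛ *ₛ f ≗ f
*ₛ-identityˡ f zero    = ℤ.*-identityˡ (f 0)
*ₛ-identityˡ f (suc n) =
  trans (cong₂ ℤ._+_ (ℤ.*-identityˡ (f (suc n))) (*ₛ-zeroˡ f n)) (ℤ.+-identityʳ _)

-- The Cauchy product can also be unfolded at its second factor.
*ₛ-unfoldʳ : ∀ f g n → (f *ₛ g) (suc n) ≡ f (suc n) ℤ.* g 0 ℤ.+ (f *ₛ shift g) n
*ₛ-unfoldʳ f g zero    = ℤ.+-comm (f 0 ℤ.* g 1) (f 1 ℤ.* g 0)
*ₛ-unfoldʳ f g (suc n) =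
  trans (cong (ℤ._+_ (f 0 ℤ.* g (suc (suc n)))) (*ₛ-unfoldʳ (shift f) g n))
        (swap (f 0 ℤ.* g (suc (suc n))) (f (suc (suc n)) ℤ.* g 0) _)
  where
  swap : ∀ a b c → a ℤ.+ (b ℤ.+ c) ≡ b ℤ.+ (a ℤ.+ c)
  swap = solve-∀

*ₛ-comm : ∀ f g → f *ₛ g ≗ g *ₛ f
*ₛ-comm f g zero    = ℤ.*-comm (f 0) (g 0)
*ₛ-comm f g (suc n) = trans
  (cong₂ ℤ._+_ (ℤ.*-comm (f 0) (g (suc n))) (*ₛ-comm (shift f) g n))
  (sym (*ₛ-unfoldʳ g f n))

*ₛ-distribʳ : ∀ h f g → (f +ₛ g) *ₛ h ≗ f *ₛ h +ₛ g *ₛ h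
*ₛ-distribʳ h f g zero    = ℤ.*-distribʳ-+ (h 0) (f 0) (g 0)
*ₛ-distribʳ h f g (suc n) =
  trans (cong (ℤ._+_ ((f 0 ℤ.+ g 0) ℤ.* h (suc n)))
              (*ₛ-distribʳ h (shift f) (shift g) n))
        (regroup (f 0) (g 0) (h (suc n)) _ _)
  where
  regroup : ∀ a b c x y →
    (a ℤ.+ b) ℤ.* c ℤ.+ (x ℤ.+ y) ≡ a ℤ.* c ℤ.+ x ℤ.+ (b ℤ.* c ℤ.+ y)
  regroup = solve-∀

*ₛ-distribˡ : ∀ h f g → h *ₛ (f +ₛ g) ≗ h *ₛ f +ₛ h *ₛ g
*ₛ-distribˡ h f g n = trans (*ₛ-comm h (f +ₛ g) n)
  (trans (*ₛ-distribʳ h f g n) (cong₂ ℤ._+_ (*ₛ-comm f h n) (*ₛ-comm g h n)))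

-- Needed for associativity, since shift (f *ₛ g) is by definition the sum of
-- f 0 times shift g and shift f *ₛ g.
*ₛ-scaleˡ : ∀ c f g → (λ i → c ℤ.* f i) *ₛ g ≗ λ i → c ℤ.* (f *ₛ g) i
*ₛ-scaleˡ c f g zero    = ℤ.*-assoc c (f 0) (g 0)
*ₛ-scaleˡ c f g (suc n) =
  trans (cong (ℤ._+_ (c ℤ.* f 0 ℤ.* g (suc n))) (*ₛ-scaleˡ c (shift f) g n))
        (regroup c (f 0) (g (suc n)) _)
  where
  regroup : ∀ c a b x → c ℤ.* a ℤ.* b ℤ.+ c ℤ.* x ≡ c ℤ.* (a ℤ.* b ℤ.+ x)
  regroup = solve-∀

*ₛ-assoc : ∀ f g h → (f *ₛ g) *ₛ h ≗ f *ₛ (g *ₛ h)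
*ₛ-assoc f g h zero    = ℤ.*-assoc (f 0) (g 0) (h 0)
*ₛ-assoc f g h (suc n) = begin
  f 0 ℤ.* g 0 ℤ.* h (suc n) ℤ.+ (shift (f *ₛ g) *ₛ h) n
    ≡⟨ cong (ℤ._+_ (f 0 ℤ.* g 0 ℤ.* h (suc n)))
         (*ₛ-distribʳ h (λ i → f 0 ℤ.* shift g i) (shift f *ₛ g) n) ⟩
  f 0 ℤ.* g 0 ℤ.* h (suc n) ℤ.+
    (((λ i → f 0 ℤ.* shift g i) *ₛ h) n ℤ.+ ((shift f *ₛ g) *ₛ h) n)
    ≡⟨ cong (ℤ._+_ (f 0 ℤ.* g 0 ℤ.* h (suc n)))
         (cong₂ ℤ._+_ (*ₛ-scaleˡ (f 0) (shift g) h n) (*ₛ-assoc (shift f) g h n)) ⟩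
  f 0 ℤ.* g 0 ℤ.* h (suc n) ℤ.+
    (f 0 ℤ.* (shift g *ₛ h) n ℤ.+ (shift f *ₛ (g *ₛ h)) n)
    ≡⟨ regroup (f 0) (g 0) (h (suc n)) _ _ ⟩
  f 0 ℤ.* (g *ₛ h) (suc n) ℤ.+ (shift f *ₛ (g *ₛ h)) n ∎
  where
  open ≡-Reasoning
  regroup : ∀ a b c x y →
    a ℤ.* b ℤ.* c ℤ.+ (a ℤ.* x ℤ.+ y) ≡ a ℤ.* (b ℤ.* c ℤ.+ x) ℤ.+ y
  regroup = solve-∀

-- The ring ℤ[[q]], with pointwise equality.
seriesRing : CommutativeRing 0ℓ 0ℓ
seriesRing = record
  { Carrier           = Series
  ; _≈_               = _≗_
  ; _+_               = _+ₛ_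
  ; _*_               = _*ₛ_
  ; -_                = -ₛ_
  ; 0#                = zeroₛ
  ; 1#                = oneₛ
  ; isCommutativeRing = record
    { isRing = record
      { +-isAbelianGroup = Functions.isAbelianGroup ℕ ℤ.+-0-isAbelianGroup
      ; *-cong           = *ₛ-cong
      ; *-assoc          = *ₛ-assoc
      ; *-identity       = *ₛ-identityˡ , λ f n →
                             trans (*ₛ-comm f oneₛ n) (*ₛ-identityˡ f n)
      ; distrib          = *ₛ-distribˡ , *ₛ-distribʳ
      }
    ; *-comm = *ₛ-comm
    }
  }

module 𝕊 = CommutativeRing seriesRing
open Solver 𝕊.commutativeSemiring using (solve; _:=_; _:+_; _:*_)

-- Division by a series with constant term 1 is unambiguous.
/ₛ-unique : ∀ f g h → g 0 ≡ 1ℤ → f *ₛ g ≗ h → f ≗ h /ₛ g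
/ₛ-unique f g h g₀ eq = go
  where
  f₀ : f 0 ≡ h 0
  f₀ = trans (sym (ℤ.*-identityʳ (f 0))) (trans (cong (f 0 ℤ.*_) (sym g₀)) (eq 0))
  cancel : ∀ x y → y ≡ x ℤ.+ y ℤ.- x
  cancel = solve-∀
  rest : shift f *ₛ g ≗ λ i → h (suc i) ℤ.- h 0 ℤ.* g (suc i)
  rest i = trans (cancel (f 0 ℤ.* g (suc i)) _)
    (cong₂ ℤ._-_ (eq (suc i)) (cong (ℤ._* g (suc i)) f₀))
  go : f ≗ h /ₛ g
  go zero    = f₀
  go (suc n) = /ₛ-unique (shift f) g _ g₀ rest n

-- The q-Pascal recurrence

-- Multiplication by a power of q delays the coefficients.
shift-q^ : ∀ m f n → (q^ suc m *ₛ f) (suc n) ≡ (q^ m *ₛ f) n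
shift-q^ m f n = ℤ.+-identityˡ _

q^-+ : ∀ m n → q^ m *ₛ q^ n ≗ q^ (m + n)
q^-+ zero    n         = *ₛ-identityˡ (q^ n)
q^-+ (suc m) n zero    = refl
q^-+ (suc m) n (suc i) = trans (shift-q^ m (q^ n) i) (q^-+ m n i)

-- Both sides agree after multiplication by 1 - q, which can be divided out.
qInteger-+ : ∀ m n → qInteger m +ₛ q^ m *ₛ qInteger n ≗ qInteger (m + n)
qInteger-+ m n = /ₛ-unique _ d (oneₛ -ₛ q^ (m + n)) refl (begin
  (qInteger m +ₛ q^ m *ₛ qInteger n) *ₛ d
    ≈⟨ solve 4 (λ x p y d → ((x :+ p :* y) :* d) := (x :* d :+ p :* (y :* d))) 𝕊.refl
         (qInteger m) (q^ m) (qInteger n) d ⟩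
  qInteger m *ₛ d +ₛ q^ m *ₛ (qInteger n *ₛ d)
    ≈⟨ 𝕊.+-cong (qInteger-correct m) (𝕊.*-congˡ (qInteger-correct n)) ⟩
  (oneₛ -ₛ q^ m) +ₛ q^ m *ₛ (oneₛ -ₛ q^ n)
    ≈⟨ 𝕊.+-congˡ {oneₛ -ₛ q^ m} (𝕊.trans (x[y-z]≈xy-xz (q^ m) oneₛ (q^ n))
         (𝕊.+-cong (𝕊.*-identityʳ (q^ m)) (𝕊.-‿cong (q^-+ m n)))) ⟩
  (oneₛ -ₛ q^ m) +ₛ (q^ m -ₛ q^ (m + n))
    ≈⟨ (λ i → telescope (oneₛ i) ((q^ m) i) ((q^ (m + n)) i)) ⟩
  oneₛ -ₛ q^ (m + n) ∎)
  where
  open SetoidReasoning 𝕊.setoid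
  open RingProperties 𝕊.ring using (x[y-z]≈xy-xz)
  d = oneₛ -ₛ q^ 1
  telescope : ∀ x y z → (x ℤ.- y) ℤ.+ (y ℤ.- z) ≡ x ℤ.- z
  telescope = solve-∀

-- Generating function of the words with j ones and m zeros, by the number of
-- pairs of a zero and a later one.
gaussian : ℕ → ℕ → Series
gaussian zero    m       = oneₛ
gaussian (suc j) zero    = oneₛ
gaussian (suc j) (suc m) = gaussian j (suc m) +ₛ q^ suc j *ₛ gaussian (suc j) m

-- In the inductive step both summands become multiples of the factorial of
-- j + m + 1, with factors [j + 1] and q^(j + 1) [m + 1]; these add up to
-- [j + m + 2].
gaussian-factorial : ∀ j m →
  gaussian j m *ₛ (qFactorial j *ₛ qFactorial m) ≗ qFactorial (j + m)
gaussian-factorial zero m =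
  𝕊.trans (*ₛ-identityˡ _) (*ₛ-identityˡ (qFactorial m))
gaussian-factorial (suc j) zero rewrite +-identityʳ j =
  𝕊.trans (*ₛ-identityˡ _) (𝕊.*-identityʳ (qFactorial (suc j)))
gaussian-factorial (suc j) (suc m) = begin
  (gaussian j (suc m) +ₛ Q *ₛ gaussian (suc j) m) *ₛ
    (([j] *ₛ j!) *ₛ ([m] *ₛ m!))
    ≈⟨ solve 7 (λ g q h a b c d →
         ((g :+ q :* h) :* ((a :* b) :* (c :* d))) :=
         ((a :* (g :* (b :* (c :* d)))) :+ ((q :* c) :* (h :* ((a :* b) :* d))))) 𝕊.refl
         (gaussian j (suc m)) Q (gaussian (suc j) m) [j] j! [m] m! ⟩
  [j] *ₛ (gaussian j (suc m) *ₛ (j! *ₛ ([m] *ₛ m!))) +ₛ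
    (Q *ₛ [m]) *ₛ (gaussian (suc j) m *ₛ (([j] *ₛ j!) *ₛ m!))
    ≈⟨ 𝕊.+-cong (𝕊.*-congˡ (gaussian-factorial j (suc m)))
                (𝕊.*-congˡ (gaussian-factorial (suc j) m)) ⟩
  [j] *ₛ qFactorial (j + suc m) +ₛ (Q *ₛ [m]) *ₛ qFactorial (suc j + m)
    ≡⟨ cong (λ k → [j] *ₛ qFactorial (j + suc m) +ₛ (Q *ₛ [m]) *ₛ qFactorial k)
         (sym (+-suc j m)) ⟩
  [j] *ₛ qFactorial (j + suc m) +ₛ (Q *ₛ [m]) *ₛ qFactorial (j + suc m)
    ≈⟨ 𝕊.distribʳ (qFactorial (j + suc m)) [j] (Q *ₛ [m]) ⟨
  ([j] +ₛ Q *ₛ [m]) *ₛ qFactorial (j + suc m)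
    ≈⟨ 𝕊.*-congʳ (qInteger-+ (suc j) (suc m)) ⟩
  qFactorial (suc j + suc m) ∎
  where
  open SetoidReasoning 𝕊.setoid
  Q   = q^ suc j
  [j] = qInteger (suc j)
  j!  = qFactorial j
  [m] = qInteger (suc m)
  m!  = qFactorial m

gaussian≗qBinomial : ∀ j m → gaussian j m ≗ qBinomial (j + m) j
gaussian≗qBinomial j m = /ₛ-unique _ _ _
  (cong₂ ℤ._*_ (qFactorial₀ j) (qFactorial₀ (j + m ∸ j)))
  (subst (λ k → gaussian j m *ₛ (qFactorial j *ₛ qFactorial k) ≗ qFactorial (j + m))
    (sym (m+n∸m≡n j m)) (gaussian-factorial j m))

-- The counting function

private variable
  x : List Bool

-- K r is the number of ways to continue with a budget of r inversions.  Continue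
-- with the budget diminished by j, which is impossible when j exceeds the budget.
spend : ℕ → (ℕ → ℕ) → ℕ → ℕ
spend zero    K r       = K r
spend (suc j) K zero    = 0
spend (suc j) K (suc r) = spend j K r

-- The number of ways to place j ones and m zeros, paying for each zero the
-- number of ones still to be placed, and then to continue with K.
arrange : ℕ → ℕ → (ℕ → ℕ) → ℕ → ℕ
arrange zero    zero    K r = K r
arrange (suc j) zero    K r = arrange j zero K r
arrange zero    (suc m) K r = arrange zero m K r
arrange (suc j) (suc m) K r =
  arrange j (suc m) K r + spend (suc j) (arrange (suc j) m K) r

-- The generating function of a counting function of the budget.
toSeries : (ℕ → ℕ) → Series
toSeries K r = ℤ.+ K r

spend-series : ∀ j K → toSeries (spend j K) ≗ q^ j *ₛ toSeries K
spend-series zero    K r       = sym (*ₛ-identityˡ (toSeries K) r)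
spend-series (suc j) K zero    = refl
spend-series (suc j) K (suc r) =
  trans (spend-series j K r) (sym (shift-q^ j (toSeries K) r))

arrange-series : ∀ j m K → toSeries (arrange j m K) ≗ gaussian j m *ₛ toSeries K
arrange-series zero    zero    K = 𝕊.sym (*ₛ-identityˡ (toSeries K))
arrange-series (suc zero)    zero    K = 𝕊.sym (*ₛ-identityˡ (toSeries K))
arrange-series (suc (suc j)) zero    K = arrange-series (suc j) zero K
arrange-series zero    (suc m) K = arrange-series zero m K
arrange-series (suc j) (suc m) K = begin
  toSeries (arrange j (suc m) K) +ₛ toSeries (spend (suc j) (arrange (suc j) m K))
    ≈⟨ 𝕊.+-cong (arrange-series j (suc m) K)
         (𝕊.trans (spend-series (suc j) (arrange (suc j) m K))
                  (𝕊.*-congˡ (arrange-series (suc j) m K))) ⟩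
  gaussian j (suc m) *ₛ κ +ₛ Q *ₛ (gaussian (suc j) m *ₛ κ)
    ≈⟨ 𝕊.+-congˡ {gaussian j (suc m) *ₛ κ} (𝕊.*-assoc Q (gaussian (suc j) m) κ) ⟨
  gaussian j (suc m) *ₛ κ +ₛ (Q *ₛ gaussian (suc j) m) *ₛ κ
    ≈⟨ 𝕊.distribʳ κ (gaussian j (suc m)) (Q *ₛ gaussian (suc j) m) ⟨
  (gaussian j (suc m) +ₛ Q *ₛ gaussian (suc j) m) *ₛ κ ∎
  where
  open SetoidReasoning 𝕊.setoid
  Q = q^ suc j
  κ = toSeries K

arrange-zero : ∀ j m {K} → (∀ r → K r ≡ 0) → ∀ r → arrange j m K r ≡ 0
arrange-zero zero    zero    z r = z r
arrange-zero (suc j) zero    z r = arrange-zero j zero z r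
arrange-zero zero    (suc m) z r = arrange-zero zero m z r
arrange-zero (suc j) (suc m) z r =
  cong₂ _+_ (arrange-zero j (suc m) z r)
            (spend-zero (suc j) (arrange-zero (suc j) m z) r)
  where
  spend-zero : ∀ j {K} → (∀ r → K r ≡ 0) → ∀ r → spend j K r ≡ 0
  spend-zero zero    z r       = z r
  spend-zero (suc j) z zero    = refl
  spend-zero (suc j) z (suc r) = spend-zero j z r

-- At the end no letters may be left over, and no budget.
final : ℕ → ℕ → ℕ
final zero    zero    = 1
final zero    (suc r) = 0
final (suc n) r       = 0

-- The count when j ones of the current lower entry have been read, n letters
-- remain for the rest of this entry and the later ones, and x is the rest of
-- the input.  The word of the current entry is guessed at its end, when n has
-- become the number of its zeros.
blocks : List Bool → ℕ → ℕ → ℕ → ℕ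
blocks []          n       j r = arrange j n (final n) r
blocks (false ∷ x) n       j r = arrange j n (blocks x n 0) r
blocks (true ∷ x)  zero    j r = 0
blocks (true ∷ x)  (suc n) j r = blocks x n (suc j) r

-- The count when n is known and r ones of the second unary number were read.
second : List Bool → ℕ → ℕ → ℕ
second []          n r = 0
second (false ∷ x) n r = blocks x n 0 r
second (true ∷ x)  n r = second x n (suc r)

-- The count when n ones of the first unary number have been read.
first : List Bool → ℕ → ℕ
first []          n = 0
first (false ∷ x) n = second x n 0
first (true ∷ x)  n = first x (suc n)

count : List Bool → ℕ
count x = first x 0

-- The encoding of all lower entries but the first, with their separators.
tail : List ℕ → List Bool
tail = concatMap (λ a → false ∷ ones a)

first-ones : ∀ a n → first (ones a ++ x) n ≡ first x (a + n)
first-ones zero        n = refl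
first-ones {x} (suc a) n =
  trans (first-ones a (suc n)) (cong (first x) (+-suc a n))

second-ones : ∀ a n r → second (ones a ++ x) n r ≡ second x n (a + r)
second-ones zero        n r = refl
second-ones {x} (suc a) n r =
  trans (second-ones a n (suc r)) (cong (second x n) (+-suc a r))

blocks-ones : ∀ a n j → blocks (ones a ++ x) (a + n) j ≗ blocks x n (a + j)
blocks-ones zero        n j r = refl
blocks-ones {x} (suc a) n j r =
  trans (blocks-ones a n (suc j) r) (cong (λ k → blocks x n k r) (+-suc a j))

final-series : toSeries (final 0) ≗ oneₛ
final-series zero    = refl
final-series (suc r) = refl

-- At the end of a lower entry equal to j, the count is a coefficient of the
-- q-multinomial coefficient whose lower entries are j and the ones ahead.
blocks-series : ∀ j as →
  toSeries (blocks (tail as) (sum as) j) ≗ qMultinomial (j + sum as) (j ∷ as)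
blocks-series j as = begin
  toSeries (blocks (tail as) (sum as) j)
    ≈⟨ unfold as ⟩
  gaussian j (sum as) *ₛ qMultinomial (sum as) as
    ≈⟨ 𝕊.*-congʳ (gaussian≗qBinomial j (sum as)) ⟩
  qBinomial (j + sum as) j *ₛ qMultinomial (sum as) as
    ≡⟨ cong (λ m → qBinomial (j + sum as) j *ₛ qMultinomial m as)
         (sym (m+n∸m≡n j (sum as))) ⟩
  qMultinomial (j + sum as) (j ∷ as) ∎
  where
  open SetoidReasoning 𝕊.setoid
  unfold : ∀ as → toSeries (blocks (tail as) (sum as) j) ≗
                  gaussian j (sum as) *ₛ qMultinomial (sum as) as
  unfold [] = 𝕊.trans (arrange-series j 0 (final 0)) (𝕊.*-congˡ final-series)
  unfold (a ∷ as) = 𝕊.trans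
    (arrange-series j (a + sum as) (blocks (ones a ++ tail as) (a + sum as) 0))
    (𝕊.*-congˡ {gaussian j (a + sum as)} λ r →
      trans (cong ℤ.+_ (trans (blocks-ones a (sum as) 0 r)
                              (cong (λ k → blocks (tail as) (sum as) k r) (+-identityʳ a))))
            (blocks-series a as r))

count-encode : ∀ n r a as → sum (a ∷ as) ≡ n →
  ℤ.+ count (encode n r (a ∷ as)) ≡ coeff r (qMultinomial n (a ∷ as))
count-encode n r a as refl = begin
  ℤ.+ count (encode n r (a ∷ as))
    ≡⟨ cong ℤ.+_ (trans (first-ones n 0) (second-ones r (n + 0) 0)) ⟩
  ℤ.+ blocks (ones a ++ tail as) (n + 0) 0 (r + 0)
    ≡⟨ cong₂ (λ n r → ℤ.+ blocks (ones a ++ tail as) n 0 r)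
         (+-identityʳ n) (+-identityʳ r) ⟩
  ℤ.+ blocks (ones a ++ tail as) n 0 r
    ≡⟨ cong ℤ.+_ (blocks-ones a (sum as) 0 r) ⟩
  ℤ.+ blocks (tail as) (sum as) (a + 0) r
    ≡⟨ cong (λ k → ℤ.+ blocks (tail as) (sum as) k r) (+-identityʳ a) ⟩
  ℤ.+ blocks (tail as) (sum as) a r
    ≡⟨ blocks-series a as r ⟩
  qMultinomial n (a ∷ as) r ∎
  where open ≡-Reasoning

-- A count that is not identically zero in the budget comes from an input
-- of the right form; the two other support lemmas extend this leftwards.
blocks-support : ∀ x n j → (∀ r → blocks x n j r ≡ 0) ⊎
  ∃₂ λ a as → x ≡ ones a ++ tail as × a + sum as ≡ n
blocks-support [] zero    j = inj₂ (0 , [] , refl , refl)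
blocks-support [] (suc n) j = inj₁ (arrange-zero j (suc n) λ _ → refl)
blocks-support (false ∷ x) n j with blocks-support x n 0
... | inj₁ z                    = inj₁ (arrange-zero j n z)
... | inj₂ (a , as , refl , eq) = inj₂ (0 , a ∷ as , refl , eq)
blocks-support (true ∷ x) zero    j = inj₁ λ _ → refl
blocks-support (true ∷ x) (suc n) j with blocks-support x n (suc j)
... | inj₁ z                      = inj₁ z
... | inj₂ (a , as , refl , refl) = inj₂ (suc a , as , refl , refl)

second-support : ∀ x n r → second x n r ≡ 0 ⊎
  ∃ λ s → ∃₂ λ a as → x ≡ ones s ++ tail (a ∷ as) × a + sum as ≡ n
second-support [] n r = inj₁ refl
second-support (false ∷ x) n r with blocks-support x n 0
... | inj₁ z                    = inj₁ (z r)
... | inj₂ (a , as , refl , eq) = inj₂ (0 , a , as , refl , eq)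
second-support (true ∷ x) n r with second-support x n (suc r)
... | inj₁ z                        = inj₁ z
... | inj₂ (s , a , as , refl , eq) = inj₂ (suc s , a , as , refl , eq)

first-support : ∀ x n → first x n ≡ 0 ⊎
  ∃₂ λ m r → ∃₂ λ a as → x ≡ encode m r (a ∷ as) × a + sum as ≡ m + n
first-support [] n = inj₁ refl
first-support (false ∷ x) n with second-support x n 0
... | inj₁ z                        = inj₁ z
... | inj₂ (r , a , as , refl , eq) = inj₂ (0 , r , a , as , refl , eq)
first-support (true ∷ x) n with first-support x (suc n)
... | inj₁ z = inj₁ z
... | inj₂ (m , r , a , as , refl , eq) =
  inj₂ (suc m , r , a , as , refl , trans eq (+-suc m n))

count-elsewhere : ∀ x →
  (∀ n r a as → sum (a ∷ as) ≡ n → x ≢ encode n r (a ∷ as)) → count x ≡ 0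
count-elsewhere x bad with first-support x 0
... | inj₁ z = z
... | inj₂ (n , r , a , as , eq , s) =
  ⊥-elim (bad n r a as (trans s (+-identityʳ n)) eq)

count-isQMultinomialCoeff : IsQMultinomialCoeff count
count-isQMultinomialCoeff = record
  { on-encodings = count-encode
  ; elsewhere    = count-elsewhere
  }

-- Acceptance, halting and space of a configuration

module Behaviour (M : Machine) (x : List Bool) (S : ℕ) where
  open Machine M
  open Run M x

  -- All runs from c halt and stay within space S, and n of them accept.
  record _accepts_ (c : Config) (n : ℕ) : Set where
    field
      halts : Acc (flip _⟶_) c
      paths : AcceptingPath c ↔ Fin n
      small : ∀ {d} → Star _⟶_ c d → space d ≤ S

  open _accepts_ public

  -- The successors of c by the listed transitions, with the sum of their numbers
  -- of accepting paths.
  data Branches (c : Config) : List (Transition State Γ workTapes) → ℕ → Set where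
    []  : Branches c [] 0
    _∷_ : ∀ {t ts m n} → apply t c accepts m → Branches c ts n →
          Branches c (t ∷ ts) (m + n)

  branch-at : ∀ {c ts n t} → Branches c ts n → t ∈ ts → ∃ λ m → apply t c accepts m
  branch-at (b ∷ bs) (here refl) = _ , b
  branch-at (b ∷ bs) (there t∈)  = branch-at bs t∈

  branch-paths : ∀ {c ts n} → Branches c ts n →
                 Any (λ t → AcceptingPath (apply t c)) ts ↔ Fin n
  branch-paths []       = ↔-sym 0↔⊥ ↔-∘ ↔-sym ⊥↔Any[]
  branch-paths (b ∷ bs) =
    ↔-sym +↔⊎ ↔-∘ ((paths b ⊎-↔ branch-paths bs) ↔-∘ ↔-sym (∷↔ _))

  -- A configuration that can move has the accepting paths of its successors.
  step-paths : ∀ {c} → transitions c ≢ [] →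
    AcceptingPath c ↔ Any (λ t → AcceptingPath (apply t c)) (transitions c)
  step-paths {c} moves = Any↔ ↔-∘ mk↔ₛ′ to from (λ _ → refl) inverse
    where
    to : AcceptingPath c → ∃ λ t → t ∈ transitions c × AcceptingPath (apply t c)
    to (accept stop _)     = ⊥-elim (moves stop)
    to (step (fire t∈) ps) = _ , t∈ , ps
    from : (∃ λ t → t ∈ transitions c × AcceptingPath (apply t c)) → AcceptingPath c
    from (_ , t∈ , ps) = step (fire t∈) ps
    inverse : ∀ ps → from (to ps) ≡ ps
    inverse (accept stop _)     = ⊥-elim (moves stop)
    inverse (step (fire t∈) ps) = refl

  branch : ∀ {c t ts n} → transitions c ≡ t ∷ ts → space c ≤ S →
           Branches c (t ∷ ts) n → c accepts n
  branch {c} {t} {ts} {n} eq bound bs = record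
    { halts = acc λ { (fire t∈) → halts (proj₂ (at t∈)) }
    ; paths = branch-paths bs′ ↔-∘ step-paths (λ stop → nonempty (trans (sym eq) stop))
    ; small = λ { ε → bound ; (fire t∈ ◅ more) → small (proj₂ (at t∈)) more }
    }
    where
    bs′ : Branches c (transitions c) n
    bs′ = subst (λ ts → Branches c ts n) (sym eq) bs
    at : ∀ {t} → t ∈ transitions c → ∃ λ m → apply t c accepts m
    at = branch-at bs′
    nonempty : t ∷ ts ≢ []
    nonempty ()

  single : ∀ {c t n} → transitions c ≡ [ t ] → space c ≤ S →
           apply t c accepts n → c accepts n
  single {c} eq bound b =
    subst (c accepts_) (+-identityʳ _) (branch eq bound (b ∷ []))

  module _ {c : Config} (stop : transitions c ≡ []) (bound : space c ≤ S) where

    stuck : ∀ {d} → ¬ c ⟶ d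
    stuck (fire t∈) with () ← subst (_ ∈_) stop t∈

    halted : ∀ {n} → AcceptingPath c ↔ Fin n → c accepts n
    halted ps = record
      { halts = acc λ s → ⊥-elim (stuck s)
      ; paths = ps
      ; small = λ { ε → bound ; (s ◅ _) → ⊥-elim (stuck s) }
      }

    halted-accepting : accepting (state c) ≡ true → c accepts 1
    halted-accepting yes = halted
      (↔-sym 1↔⊤ ↔-∘ mk↔ₛ′ _ (λ _ → accept stop yes) (λ _ → refl) unique)
      where
      unique : ∀ p → accept stop yes ≡ p
      unique (accept p q) = cong₂ accept (≡-irrelevant stop p) (≡-irrelevant yes q)
      unique (step s _)   = ⊥-elim (stuck s)

    halted-rejecting : accepting (state c) ≡ false → c accepts 0
    halted-rejecting no = halted
      (↔-sym 0↔⊥ ↔-∘ mk↔ₛ′ none ⊥-elim (λ ()) (λ p → ⊥-elim (none p)))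
      where
      none : ¬ AcceptingPath c
      none (accept _ yes) with () ← trans (sym no) yes
      none (step s _)     = stuck s

-- Counter programs and their compilation to Turing machines

-- A program has finitely many labels, one instruction at each, and registers
-- that hold natural numbers.  Its input is read from left to right.
--   inc     increments a register.
--   dec     decrements a positive register; at zero it leaves the register
--           unchanged and jumps elsewhere.
--   choose  jumps to either of two labels, nondeterministically.  They must
--           differ, so that the two transitions of the machine differ.
--   read    inspects the next input symbol, nothing standing for the end of
--           the input, and says whether to move past it and where to jump.
--   halt    accepts or rejects.
data Instruction (labels registers : ℕ) : Set where
  inc    : Fin registers → Fin labels → Instruction labels registers
  dec    : Fin registers → (ifZero ifPositive : Fin labels) → Instruction labels registers
  choose : (l₁ l₂ : Fin labels) → l₁ ≢ l₂ → Instruction labels registers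
  read   : (Maybe Bool → Bool × Fin labels) → Instruction labels registers
  halt   : Bool → Instruction labels registers

-- The rest of the input after a read that does or does not move on.
advance : Bool → List Bool → List Bool
advance b y = if b then drop 1 y else y

module Program {labels registers} (prog : Fin labels → Instruction labels registers) where

  Label = Fin labels
  Store = Vec ℕ registers

  -- Counts B l y v n: started at label l with remaining input y and register
  -- contents v, the program always halts, no increment takes a register above B,
  -- and n of its paths accept.
  data Counts (B : ℕ) : Label → List Bool → Store → ℕ → Set where
    accepted : ∀ {l y v} → prog l ≡ halt true → Counts B l y v 1
    rejected : ∀ {l y v} → prog l ≡ halt false → Counts B l y v 0
    inc    : ∀ {l y v i l′ n} → prog l ≡ inc i l′ → lookup v i < B →
             Counts B l′ y (v [ i ]≔ suc (lookup v i)) n → Counts B l y v n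
    dec₀   : ∀ {l y v i l₀ l₁ n} → prog l ≡ dec i l₀ l₁ → lookup v i ≡ 0 →
             Counts B l₀ y v n → Counts B l y v n
    dec₊   : ∀ {l y v i l₀ l₁ u n} → prog l ≡ dec i l₀ l₁ → lookup v i ≡ suc u →
             Counts B l₁ y (v [ i ]≔ u) n → Counts B l y v n
    choose : ∀ {l y v l₁ l₂ d m n} → prog l ≡ choose l₁ l₂ d →
             Counts B l₁ y v m → Counts B l₂ y v n → Counts B l y v (m + n)
    read   : ∀ {l y v g b l′ n} → prog l ≡ read g → g (List.head y) ≡ (b , l′) →
             Counts B l′ (advance b y) v n → Counts B l y v n

  -- A label is entered in phase enter, and only counter instructions use other
  -- phases.  The work tape of a register has a blank home cell, where the head
  -- rests, and to the right of it the binary digits, least significant first.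
  -- A carry or borrow ripples to the right, and the head then returns to the home
  -- cell, recognisable as the only blank to the left of the digits.  A borrow that
  -- runs past the last digit has found the number zero; all digits are then ones
  -- and are reset to zero on the way back, in phase undo.
  data Phase : Set where
    enter ripple return undo : Phase

  State  = Label × Phase
  Symbol = Maybe Bool

  -- The next state, the symbol to write and the head move, on one work tape.
  Action = State × Symbol × Move

  incAction : Label → Label → Phase → Symbol → Action
  incAction l l′ enter  _            = (l , ripple) , nothing , right
  incAction l l′ ripple (just true)  = (l , ripple) , just false , right
  incAction l l′ ripple _            = (l , return) , just true , left
  incAction l l′ return (just b)     = (l , return) , just b , left
  incAction l l′ return nothing      = (l′ , enter) , nothing , stay
  -- Never reached.
  incAction l l′ undo   s            = (l , undo) , s , stay

  decAction : Label → Label → Label → Phase → Symbol → Action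
  decAction l l₀ l₁ enter  _            = (l , ripple) , nothing , right
  decAction l l₀ l₁ ripple (just false) = (l , ripple) , just true , right
  decAction l l₀ l₁ ripple (just true)  = (l , return) , just false , left
  decAction l l₀ l₁ ripple nothing      = (l , undo) , nothing , left
  decAction l l₀ l₁ return (just b)     = (l , return) , just b , left
  decAction l l₀ l₁ return nothing      = (l₁ , enter) , nothing , stay
  decAction l l₀ l₁ undo   (just _)     = (l , undo) , just false , left
  decAction l l₀ l₁ undo   nothing      = (l₀ , enter) , nothing , stay

  -- No change to the work tapes, given the symbols under their heads.
  keep : ∀ {k} → Vec Symbol k → Vec (Symbol × Move) k
  keep = Vec.map (_, stay)

  -- An action on one work tape, the input head and the other tapes at rest.
  on : Fin registers → Vec Symbol registers → Action → Transition State Symbol registers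
  on i w (s , g , m) = transition s stay (keep w [ i ]≔ (g , m))

  -- A jump that may move the input head but changes no work tape.
  jump : Label → Move → Vec Symbol registers → Transition State Symbol registers
  jump l m w = transition (l , enter) m (keep w)

  symbol : Maybe Bool → InputSymbol
  symbol nothing  = ⊣
  symbol (just b) = bit b

  readMove : Bool → Move
  readMove b = if b then right else stay

  -- At the left end marker, where the head starts, the instruction is delayed
  -- until the head has moved onto the input.
  reading : Label → (Maybe Bool → Bool × Label) → InputSymbol →
            Vec Symbol registers → Transition State Symbol registers
  reading l g ⊢       w = jump l right w
  reading l g ⊣       w = let (b , l′) = g nothing in jump l′ (readMove b) w
  reading l g (bit a) w = let (b , l′) = g (just a) in jump l′ (readMove b) w

  execute : Instruction labels registers → State → InputSymbol → Vec Symbol registers →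
            List (Transition State Symbol registers)
  execute (inc i l′)       (l , ph) a w = [ on i w (incAction l l′ ph (lookup w i)) ]
  execute (dec i l₀ l₁)    (l , ph) a w = [ on i w (decAction l l₀ l₁ ph (lookup w i)) ]
  execute (choose l₁ l₂ _) (l , ph) a w = jump l₁ stay w ∷ jump l₂ stay w ∷ []
  execute (read g)         (l , ph) a w = [ reading l g a w ]
  execute (halt _)         (l , ph) a w = []

  execute-unique : ∀ ins s a w → Unique (execute ins s a w)
  execute-unique (inc i l′)       s a w = All.[] AllPairs.∷ AllPairs.[]
  execute-unique (dec i l₀ l₁)    s a w = All.[] AllPairs.∷ AllPairs.[]
  execute-unique (choose l₁ l₂ d) s a w =
    ((λ eq → d (cong (proj₁ ∘ Transition.next) eq)) All.∷ All.[])
      AllPairs.∷ All.[] AllPairs.∷ AllPairs.[]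
  execute-unique (read g)         s a w = All.[] AllPairs.∷ AllPairs.[]
  execute-unique (halt _)         s a w = AllPairs.[]

  accepts? : Instruction labels registers → Bool
  accepts? (halt b) = b
  accepts? _        = false

  finitePhase : Finite Phase
  finitePhase = 4 , mk↔ₛ′ to from to∘from from∘to
    where
    to : Phase → Fin 4
    to enter  = zero
    to ripple = suc zero
    to return = suc (suc zero)
    to undo   = suc (suc (suc zero))
    from : Fin 4 → Phase
    from zero                   = enter
    from (suc zero)             = ripple
    from (suc (suc zero))       = return
    from (suc (suc (suc zero))) = undo
    to∘from : ∀ i → to (from i) ≡ i
    to∘from zero                   = refl
    to∘from (suc zero)             = refl
    to∘from (suc (suc zero))       = refl
    to∘from (suc (suc (suc zero))) = refl
    from∘to : ∀ p → from (to p) ≡ p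
    from∘to enter  = refl
    from∘to ripple = refl
    from∘to return = refl
    from∘to undo   = refl

  finiteSymbol : Finite Symbol
  finiteSymbol = 3 , mk↔ₛ′ to from to∘from from∘to
    where
    to : Symbol → Fin 3
    to nothing      = zero
    to (just false) = suc zero
    to (just true)  = suc (suc zero)
    from : Fin 3 → Symbol
    from zero             = nothing
    from (suc zero)       = just false
    from (suc (suc zero)) = just true
    to∘from : ∀ i → to (from i) ≡ i
    to∘from zero             = refl
    to∘from (suc zero)       = refl
    to∘from (suc (suc zero)) = refl
    from∘to : ∀ s → from (to s) ≡ s
    from∘to nothing      = refl
    from∘to (just false) = refl
    from∘to (just true)  = refl

  -- The machine that executes the program from the given label.
  machine : Label → Machine
  machine start = record
    { State       = State
    ; finiteState = labels * 4 , (↔-sym *↔× ↔-∘ (↔-id _ ×-↔ proj₂ finitePhase))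
    ; Γ           = Symbol
    ; finiteΓ     = finiteSymbol
    ; blank       = nothing
    ; workTapes   = registers
    ; start       = start , enter
    ; accepting   = λ (l , _) → accepts? (prog l)
    ; δ           = λ (l , ph) → execute (prog l) (l , ph)
    ; δ-unique    = λ (l , ph) → execute-unique (prog l) (l , ph)
    }

  digit : Bool → ℕ
  digit false = 0
  digit true  = 1

  -- The number written on the cells to the right of the home cell.
  value : List Symbol → ℕ
  value []             = 0
  value (nothing ∷ ds) = 0
  value (just b ∷ ds)  = digit b + 2 * value ds

  -- At most L binary digits, possibly followed by one blank cell, which is left
  -- behind when a borrow has run past the last digit.  Leading zeros are allowed.
  data Digits : ℕ → List Symbol → Set where
    end   : ∀ {L} → Digits L []
    blank : ∀ {L} → Digits L (nothing ∷ [])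
    _∷_   : ∀ {L ds} b → Digits L ds → Digits (suc L) (just b ∷ ds)

  Digits-length : ∀ {L ds} → Digits L ds → length ds ≤ suc L
  Digits-length end      = z≤n
  Digits-length blank    = s≤s z≤n
  Digits-length (b ∷ ds) = s≤s (Digits-length ds)

  -- The cells to the left of a head that has passed the digits ls, most recent
  -- first, on its way from the home cell.
  below : List Bool → List Symbol
  below ls = map just ls ++ [ nothing ]

  -- The tape with ls to the left, and with its head on the first cell of the given
  -- cells, or on a fresh blank if there are none.
  standing : List Symbol → List Symbol → Tape Symbol
  standing ls []       = tape ls nothing []
  standing ls (d ∷ ds) = tape ls d ds

  -- The tape with its head on the first of the cells below ls, on the way home, and
  -- with ds to the right of it.
  returning : List Bool → List Symbol → Tape Symbol
  returning []       ds = tape [] nothing ds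
  returning (b ∷ ls) ds = tape (below ls) (just b) ds

  move-right : ∀ ls c ds → moveTape nothing right (tape ls c ds) ≡ standing (c ∷ ls) ds
  move-right ls c []       = refl
  move-right ls c (d ∷ ds) = refl

  move-left : ∀ ls c ds → moveTape nothing left (tape (below ls) c ds) ≡ returning ls (c ∷ ds)
  move-left []       c ds = refl
  move-left (b ∷ ls) c ds = refl

  below-length : ∀ ls → length (below ls) ≡ suc (length ls)
  below-length ls = trans (length-++ (map just ls))
    (trans (cong (_+ 1) (length-map just ls)) (+-comm (length ls) 1))

  standing-visited : ∀ ls c rs → visited (tape (below ls) c rs) ≡ 2 + (length ls + length rs)
  standing-visited ls c rs rewrite below-length ls | +-comm (length ls) 1 = refl

  returning-visited : ∀ ls ds → visited (returning ls ds) ≡ suc (length ls + length ds)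
  returning-visited []       ds = refl
  returning-visited (b ∷ ls) ds = standing-visited ls (just b) ds

  -- Runs of the compiled machine on x, for registers of at most L digits.  Each
  -- work tape then has at most W cells: digits, home cell and one trailing blank.
  module Simulation (start : Label) (x : List Bool) (L : ℕ) where

    M : Machine
    M = machine start

    W S : ℕ
    W = 2 + L
    S = registers * W

    open Run M x using (Config; config; transitions; space; act; apply)
    open Behaviour M x S

    standing-small : ∀ {K ds} ls → length ls + K ≤ L → Digits K ds →
                     visited (standing (below ls) ds) ≤ W
    standing-small {K} {[]} ls p ds = begin
      visited (tape (below ls) nothing []) ≡⟨ standing-visited ls nothing [] ⟩
      2 + (length ls + 0)                  ≤⟨ +-monoʳ-≤ 2 (+-monoʳ-≤ (length ls) z≤n) ⟩
      2 + (length ls + K)                  ≤⟨ +-monoʳ-≤ 2 p ⟩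
      W                                    ∎
      where open ≤-Reasoning
    standing-small {K} {d ∷ ds} ls p dds = begin
      visited (tape (below ls) d ds) ≡⟨ standing-visited ls d ds ⟩
      2 + (length ls + length ds)    ≤⟨ +-monoʳ-≤ 2
                                         (+-monoʳ-≤ (length ls) (≤-pred (Digits-length dds))) ⟩
      2 + (length ls + K)            ≤⟨ +-monoʳ-≤ 2 p ⟩
      W                              ∎
      where open ≤-Reasoning

    returning-small : ∀ {K ds} ls → length ls + K ≤ L → Digits K ds →
                      visited (returning ls ds) ≤ W
    returning-small {K} {ds} ls p dds = begin
      visited (returning ls ds)     ≡⟨ returning-visited ls ds ⟩
      suc (length ls + length ds)   ≤⟨ s≤s (+-monoʳ-≤ (length ls) (Digits-length dds)) ⟩
      suc (length ls + suc K)       ≡⟨ cong suc (+-suc (length ls) K) ⟩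
      2 + (length ls + K)           ≤⟨ +-monoʳ-≤ 2 p ⟩
      W                             ∎
      where open ≤-Reasoning

    Tapes : Set
    Tapes = Vec (Tape Symbol) registers

    Small : ∀ {k} → Vec (Tape Symbol) k → Set
    Small = VecAll.All (λ t → visited t ≤ W)

    sum-small : ∀ {k} {ts : Vec (Tape Symbol) k} → Small ts →
                Vec.sum (Vec.map visited ts) ≤ k * W
    sum-small []       = z≤n
    sum-small (p ∷ ps) = +-mono-≤ p (sum-small ps)

    small-update : ∀ {k} {ts : Vec (Tape Symbol) k} i {t} →
                   Small ts → visited t ≤ W → Small (ts [ i ]≔ t)
    small-update zero    (_ ∷ ps) q = q ∷ ps
    small-update (suc i) (p ∷ ps) q = p ∷ small-update i ps q

    act-keep : ∀ {k} (ts : Vec (Tape Symbol) k) →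
               Vec.zipWith act (keep (Vec.map head ts)) ts ≡ ts
    act-keep []       = refl
    act-keep (t ∷ ts) = cong (t ∷_) (act-keep ts)

    act-on : ∀ {k} i a (ts : Vec (Tape Symbol) k) →
             Vec.zipWith act (keep (Vec.map head ts) [ i ]≔ a) ts ≡
             ts [ i ]≔ act a (lookup ts i)
    act-on zero    a (t ∷ ts) = cong (act a t ∷_) (act-keep ts)
    act-on (suc i) a (t ∷ ts) = cong (t ∷_) (act-on i a ts)

    -- A counter instruction at label l that works on register i.  The lemmas run
    -- the machine backwards: what holds of the configuration after a computation
    -- also holds of the configuration before it.
    module Counter (l : Label) (i : Fin registers) (p : ℕ)
      (ts : Tapes) (small-ts : Small ts)
      (action : Phase → Symbol → Action)
      (δ-action : ∀ ph w → Machine.δ M (l , ph) (scan x p) w ≡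
                           [ on i w (action ph (lookup w i)) ])
      where

      -- The tapes ts with tape i replaced by the given one.
      with-tape : State → Tape Symbol → Config
      with-tape s t = config s p (ts [ i ]≔ t)

      -- One step of the machine.
      tick : ∀ {ph t s g m n} → action ph (head t) ≡ (s , g , m) → visited t ≤ W →
             with-tape s (moveTape nothing m (writeTape g t)) accepts n →
             with-tape (l , ph) t accepts n
      tick {ph} {t} {s} {g} {m} {n} eq q b =
        single fires (sum-small (small-update i small-ts q))
          (subst (λ us → config s p us accepts n) (sym effect) b)
        where
        us = ts [ i ]≔ t
        reads : lookup (Vec.map head us) i ≡ head t
        reads = trans (lookup-map i head us) (cong head (lookup∘update i ts t))
        fires : transitions (with-tape (l , ph) t) ≡ [ on i (Vec.map head us) (s , g , m) ]
        fires = trans (δ-action ph _)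
          (cong (λ a → [ on i (Vec.map head us) a ]) (trans (cong (action ph) reads) eq))
        effect : Vec.zipWith act (keep (Vec.map head us) [ i ]≔ (g , m)) us ≡
                 ts [ i ]≔ act (g , m) t
        effect = trans (act-on i (g , m) us)
          (trans ([]≔-idempotent ts i)
                 (cong (λ u → ts [ i ]≔ act (g , m) u) (lookup∘update i ts t)))

      tick-right : ∀ {ph ls c ds s g n} → action ph c ≡ (s , g , right) →
                   visited (tape ls c ds) ≤ W →
                   with-tape s (standing (g ∷ ls) ds) accepts n →
                   with-tape (l , ph) (tape ls c ds) accepts n
      tick-right {ls = ls} {ds = ds} {s} {g} {n} eq q b =
        tick eq q (subst (λ t → with-tape s t accepts n) (sym (move-right ls g ds)) b)

      tick-left : ∀ {ph c ds s g n} ls → action ph c ≡ (s , g , left) →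
                  visited (tape (below ls) c ds) ≤ W →
                  with-tape s (returning ls (g ∷ ds)) accepts n →
                  with-tape (l , ph) (tape (below ls) c ds) accepts n
      tick-left {ds = ds} {s} {g} {n} ls eq q b =
        tick eq q (subst (λ t → with-tape s t accepts n) (sym (move-left ls g ds)) b)

      -- The way home rewrites each digit by φ.
      walk-home : ∀ {ph s n} (φ : Bool → Bool) →
        (∀ b → action ph (just b) ≡ ((l , ph) , just (φ b) , left)) →
        action ph nothing ≡ (s , nothing , stay) →
        ∀ ls {ds} → visited (returning ls ds) ≤ W →
        with-tape s (tape [] nothing (map (just ∘ φ) ls ʳ++ ds)) accepts n →
        with-tape (l , ph) (returning ls ds) accepts n
      walk-home φ turn stop [] q b = tick stop q b
      walk-home {ph} φ turn stop (a ∷ ls) {ds} q b =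
        tick-left ls (turn a) q
          (walk-home φ turn stop ls {just (φ a) ∷ ds} q′ b)
        where
        q′ : visited (returning ls (just (φ a) ∷ ds)) ≤ W
        q′ = ≤-trans (≤-reflexive (trans (returning-visited ls (just (φ a) ∷ ds))
               (trans (cong suc (+-suc (length ls) (length ds)))
                      (sym (standing-visited ls (just a) ds))))) q

      -- The head of tape i rests on its home cell, followed by ds.
      home : State → List Symbol → Config
      home s ds = with-tape s (tape [] nothing ds)

      enter-ripple : ∀ {ph s ds n} → action ph nothing ≡ (s , nothing , right) →
        Digits L ds →
        with-tape s (standing (below []) ds) accepts n → home (l , ph) ds accepts n
      enter-ripple eq dds = tick-right eq (returning-small [] ≤-refl dds)

    module Increment (l l′ : Label) (i : Fin registers) (p : ℕ)
      (ts : Tapes) (small-ts : Small ts) (eq : prog l ≡ inc i l′) where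

      open Counter l i p ts small-ts (incAction l l′)
        (λ ph w → cong (λ ins → execute ins (l , ph) (scan x p) w) eq)

      return-home : ∀ ls {K ds n} → length ls + K ≤ L → Digits K ds →
        home (l′ , enter) (map just ls ʳ++ ds) accepts n →
        with-tape (l , return) (returning ls ds) accepts n
      return-home ls q dds =
        walk-home id (λ _ → refl) refl ls (returning-small ls q dds)

      -- The digits ls have been passed, and ds is incremented.  Since value ds + 1 is
      -- less than 2 ^ K, a new digit is appended only when there are fewer than K.
      ripple-inc : ∀ {K ds n} ls → length ls + K ≤ L → Digits K ds →
        suc (value ds) < 2 ^ K →
        (∀ {es} → Digits K es → value es ≡ suc (value ds) →
          home (l′ , enter) (map just ls ʳ++ es) accepts n) →
        with-tape (l , ripple) (standing (below ls) ds) accepts n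
      ripple-inc {zero}  ls q end   (s≤s ()) k
      ripple-inc {zero}  ls q blank (s≤s ()) k
      ripple-inc {suc K} ls q end   r k =
        tick-left ls refl (standing-small ls q end)
          (return-home ls q (true ∷ end) (k (true ∷ end) refl))
      ripple-inc {suc K} ls q blank r k =
        tick-left ls refl (standing-small ls q blank)
          (return-home ls q (true ∷ end) (k (true ∷ end) refl))
      ripple-inc {suc K} ls q (false ∷ ds) r k =
        tick-left ls refl (standing-small ls q (false ∷ ds))
          (return-home ls q (true ∷ ds) (k (true ∷ ds) refl))
      ripple-inc {suc K} ls q (_∷_ {ds = ds} true dds) r k =
        tick-right refl (standing-small ls q (true ∷ dds))
          (ripple-inc (false ∷ ls) (≤-trans (≤-reflexive (sym (+-suc (length ls) K))) q) dds
            (*-cancelˡ-< 2 _ _ (subst (_< 2 * 2 ^ K) (sym (double-suc (value ds))) r))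
            (λ {es} ees e → k (false ∷ ees) (trans (cong (2 *_) e) (double-suc (value ds)))))
        where
        double-suc : ∀ n → 2 * suc n ≡ 2 + 2 * n
        double-suc n = *-suc 2 n

      increment : ∀ {ds n} → Digits L ds → suc (value ds) < 2 ^ L →
        (∀ {es} → Digits L es → value es ≡ suc (value ds) →
          home (l′ , enter) es accepts n) →
        home (l , enter) ds accepts n
      increment dds r k = enter-ripple refl dds (ripple-inc [] ≤-refl dds r k)

    module Decrement (l l₀ l₁ : Label) (i : Fin registers) (p : ℕ)
      (ts : Tapes) (small-ts : Small ts) (eq : prog l ≡ dec i l₀ l₁) where

      open Counter l i p ts small-ts (decAction l l₀ l₁)
        (λ ph w → cong (λ ins → execute ins (l , ph) (scan x p) w) eq)

      -- The digits ls have been passed by the borrow, and ds is decremented.  If the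
      -- value of ds is zero, the passed digits are reset to zeros on the way home.
      ripple-dec : ∀ {K ds n} ls → length ls + K ≤ L → Digits K ds →
        (∀ {es} → Digits K es → value ds ≡ 0 → value es ≡ 0 →
          home (l₀ , enter) (map (just ∘ const false) ls ʳ++ es) accepts n) →
        (∀ {es} → Digits K es → value ds ≡ suc (value es) →
          home (l₁ , enter) (map just ls ʳ++ es) accepts n) →
        with-tape (l , ripple) (standing (below ls) ds) accepts n
      ripple-dec {K} ls q end k₀ k₊ =
        tick-left ls refl (standing-small ls q end)
          (walk-home (const false) (λ _ → refl) refl ls (returning-small ls q (blank {K}))
            (k₀ blank refl refl))
      ripple-dec {K} ls q blank k₀ k₊ =
        tick-left ls refl (standing-small ls q (blank {K}))
          (walk-home (const false) (λ _ → refl) refl ls (returning-small ls q (blank {K}))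
            (k₀ blank refl refl))
      ripple-dec {suc K} ls q (_∷_ {ds = ds} false dds) k₀ k₊ =
        tick-right refl (standing-small ls q (false ∷ dds))
          (ripple-dec (true ∷ ls) (≤-trans (≤-reflexive (sym (+-suc (length ls) K))) q) dds
            (λ ees z e → k₀ (false ∷ ees) (cong (2 *_) z) (cong (2 *_) e))
            (λ {es} ees e → k₊ (true ∷ ees) (trans (cong (2 *_) e) (*-suc 2 (value es)))))
      ripple-dec {suc K} ls q (true ∷ dds) k₀ k₊ =
        tick-left ls refl (standing-small ls q (true ∷ dds))
          (walk-home id (λ _ → refl) refl ls (returning-small ls q (false ∷ dds))
            (k₊ (false ∷ dds) refl))

      decrement : ∀ {ds n} → Digits L ds →
        (∀ {es} → Digits L es → value ds ≡ 0 → value es ≡ 0 →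
          home (l₀ , enter) es accepts n) →
        (∀ {es} → Digits L es → value ds ≡ suc (value es) →
          home (l₁ , enter) es accepts n) →
        home (l , enter) ds accepts n
      decrement dds k₀ k₊ = enter-ripple refl dds (ripple-dec [] ≤-refl dds k₀ k₊)

    -- A resting tape that holds the number n.
    data Holds : ℕ → Tape Symbol → Set where
      holds : ∀ {n ds} → Digits L ds → value ds ≡ n → Holds n (tape [] nothing ds)

    Represents : Store → Tapes → Set
    Represents v ts = Pointwise Holds v ts

    Holds-small : ∀ {n t} → Holds n t → visited t ≤ W
    Holds-small (holds dds _) = returning-small [] ≤-refl dds

    Represents-small : ∀ {k} {v : Vec ℕ k} {ts : Vec (Tape Symbol) k} →
                       Pointwise Holds v ts → Small ts
    Represents-small []       = []
    Represents-small (h ∷ hs) = Holds-small h ∷ Represents-small hs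

    update : ∀ {k} {v : Vec ℕ k} {ts : Vec (Tape Symbol) k} {n t} i →
             Pointwise Holds v ts → Holds n t →
             Pointwise Holds (v [ i ]≔ n) (ts [ i ]≔ t)
    update zero    (_ ∷ hs) h′ = h′ ∷ hs
    update (suc i) (h ∷ hs) h′ = h ∷ update i hs h′

    -- The input head is at the beginning of the suffix y of the input, or on the
    -- right end marker if y is empty.
    Facing : ℕ → List Bool → Set
    Facing p y = ∃ λ pre → x ≡ pre ++ y × p ≡ suc (length pre)

    scan-++ : ∀ pre y → scan (pre ++ y) (suc (length pre)) ≡ symbol (List.head y)
    scan-++ []        []      = refl
    scan-++ []        (_ ∷ _) = refl
    scan-++ (_ ∷ pre) y       = scan-++ pre y

    scan-facing : ∀ {p y} → Facing p y → scan x p ≡ symbol (List.head y)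
    scan-facing {y = y} (pre , refl , refl) = scan-++ pre y

    facing-advance : ∀ b {p y} → Facing p y →
                     Facing (moveInput x (readMove b) p) (advance b y)
    facing-advance false f = f
    -- At the right end marker a move to the right has no effect.
    facing-advance true {y = []} (pre , refl , refl) = pre , refl ,
      trans (cong ((2 + length pre) ⊓_) (cong (suc ∘ length) (++-identityʳ pre)))
            (m≥n⇒m⊓n≡n (n≤1+n _))
    facing-advance true {y = c ∷ y} (pre , refl , refl) =
      pre ∷ʳ c , sym (++-assoc pre [ c ] y) ,
      trans (m≤n⇒m⊓n≡m (s≤s inside))
            (cong suc (sym (trans (length-++ pre) (+-comm (length pre) 1))))
      where
      open ≤-Reasoning
      inside : suc (length pre) ≤ length (pre ++ c ∷ y)
      inside = begin
        suc (length pre)            ≡⟨ +-comm 1 (length pre) ⟩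
        length pre + 1              ≤⟨ +-monoʳ-≤ (length pre) (s≤s z≤n) ⟩
        length pre + suc (length y) ≡⟨ length-++ pre ⟨
        length (pre ++ c ∷ y)       ∎

    jumped : ∀ l p m (ts : Tapes) {l′} →
             apply (jump l′ m (Vec.map head ts)) (config (l , enter) p ts) ≡
             config (l′ , enter) (moveInput x m p) ts
    jumped l p m ts = cong (config _ _) (act-keep ts)

    reading-symbol : ∀ l g s (w : Vec Symbol registers) →
                     reading l g (symbol s) w ≡ jump (proj₂ (g s)) (readMove (proj₁ (g s))) w
    reading-symbol l g nothing  w = refl
    reading-symbol l g (just _) w = refl

    -- The machine does what Counts says of the program.
    simulate : ∀ {B l y v n} → B < 2 ^ L → Counts B l y v n →
      ∀ {p ts} → Facing p y → Represents v ts → config (l , enter) p ts accepts n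
    simulate {l = l} B< (accepted eq) {p} {ts} f rep =
      halted-accepting (cong (λ ins → execute ins (l , enter) (scan x p) (Vec.map head ts)) eq)
        (sum-small (Represents-small rep)) (cong accepts? eq)
    simulate {l = l} B< (rejected eq) {p} {ts} f rep =
      halted-rejecting (cong (λ ins → execute ins (l , enter) (scan x p) (Vec.map head ts)) eq)
        (sum-small (Represents-small rep)) (cong accepts? eq)
    simulate {l = l} {y} {v} {n} B< (inc {i = i} {l′} eq v<B cs) {p} {ts} f rep
      with lookup ts i in at-i | Pointwise.lookup rep i
    ... | _ | holds {ds = ds} dds val =
      subst (λ us → config (l , enter) p us accepts n)
        (trans (cong (ts [ i ]≔_) (sym at-i)) ([]≔-lookup ts i))
        (increment dds (≤-trans (s≤s (≤-trans (≤-reflexive (cong suc val)) v<B)) B<)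
          (λ ees e → simulate B< cs f (update i rep (holds ees (trans e (cong suc val))))))
      where open Increment l l′ i p ts (Represents-small rep) eq
    simulate {l = l} {n = n} B< (dec₀ {i = i} {l₀} {l₁} eq v≡0 cs) {p} {ts} f rep
      with lookup ts i in at-i | Pointwise.lookup rep i
    ... | _ | holds {ds = ds} dds val =
      subst (λ us → config (l , enter) p us accepts n)
        (trans (cong (ts [ i ]≔_) (sym at-i)) ([]≔-lookup ts i))
        (decrement dds
          (λ ees _ e → simulate B< cs f
            (subst (λ u → Represents u _) ([]≔-lookup _ i)
              (update i rep (holds ees (trans e (sym v≡0))))))
          (λ _ e → ⊥-elim (1+n≢0 (trans (sym e) (trans val v≡0)))))
      where open Decrement l l₀ l₁ i p ts (Represents-small rep) eq
    simulate {l = l} {n = n} B< (dec₊ {i = i} {l₀} {l₁} eq v≡u cs) {p} {ts} f rep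
      with lookup ts i in at-i | Pointwise.lookup rep i
    ... | _ | holds {ds = ds} dds val =
      subst (λ us → config (l , enter) p us accepts n)
        (trans (cong (ts [ i ]≔_) (sym at-i)) ([]≔-lookup ts i))
        (decrement dds
          (λ _ z _ → ⊥-elim (1+n≢0 (trans (sym v≡u) (trans (sym val) z))))
          (λ ees e → simulate B< cs f
            (update i rep (holds ees (suc-injective (trans (sym e) (trans val v≡u)))))))
      where open Decrement l l₀ l₁ i p ts (Represents-small rep) eq
    simulate {l = l} B< (choose {l₁ = l₁} {l₂} {m = m} {n} eq cs cs′) {p} {ts} f rep =
      subst (config (l , enter) p ts accepts_) (cong (m +_) (+-identityʳ n))
        (branch (cong (λ ins → execute ins (l , enter) (scan x p) (Vec.map head ts)) eq)
          (sum-small (Represents-small rep))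
          (subst (_accepts m) (sym (jumped l p stay ts)) (simulate B< cs f rep) ∷
           subst (_accepts n) (sym (jumped l p stay ts)) (simulate B< cs′ f rep) ∷ []))
    simulate {l = l} {y} {n = n} B< (read {g = g} {b} eq g≡ cs) {p} {ts} f rep =
      single
        (trans (cong (λ ins → execute ins (l , enter) (scan x p) (Vec.map head ts)) eq)
          (cong [_] (trans (cong (λ a → reading l g a (Vec.map head ts)) (scan-facing f))
            (trans (reading-symbol l g (List.head y) (Vec.map head ts))
              (cong (λ (b , l′) → jump l′ (readMove b) (Vec.map head ts)) g≡)))))
        (sum-small (Represents-small rep))
        (subst (_accepts n) (sym (jumped l p (readMove b) ts))
          (simulate B< cs (facing-advance b f) rep))

    initial-represents : ∀ {k} → Pointwise Holds (Vec.replicate k 0)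
                                   (Vec.replicate k (tape [] nothing []))
    initial-represents {zero}  = []
    initial-represents {suc k} = holds end refl ∷ initial-represents

    -- The first step only moves the input head off the left end marker.
    simulate-initial : ∀ {g B n} → prog start ≡ read g → B < 2 ^ L →
      Counts B start x (Vec.replicate registers 0) n → Run.initial M x accepts n
    simulate-initial {n = n} eq B< cs =
      single
        (cong (λ ins → execute ins (start , enter) ⊢ (Vec.map head blanks)) eq)
        (sum-small (Represents-small {v = Vec.replicate registers 0} initial-represents))
        (subst (_accepts n) (sym (jumped start 0 right blanks))
          (simulate B< cs ([] , refl , refl) initial-represents))
      where
      blanks : Tapes
      blanks = Vec.replicate registers (tape [] nothing [])

-- The program for the q-multinomial coefficient

Register Label : Set
Register = Fin 5
Label    = Fin 24

-- While a lower entry is processed, N is the number of zeros still to be placed,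
-- J that of ones, and R the remaining budget of inversions.  M is the number of
-- zeros already placed, which restores N in the end, and T holds the part of J
-- already paid for.  While the input is read, N counts the letters not yet
-- assigned to a lower entry.
N R J M T : Register
N = # 0
R = # 1
J = # 2
M = # 3
T = # 4

scanN incN scanR incR scanA decN incJ letter one
  other incM pay decR incT refund refundJ done restore
  restoreN next finalN finalR accept reject : Label
scanN    = # 0
incN     = # 1
scanR    = # 2
incR     = # 3
scanA    = # 4
decN     = # 5
incJ     = # 6
letter   = # 7
one      = # 8
other    = # 9
incM     = # 10
pay      = # 11
decR     = # 12
incT     = # 13
refund   = # 14
refundJ  = # 15
done     = # 16
restore  = # 17
restoreN = # 18
next     = # 19
finalN   = # 20
finalR   = # 21
accept   = # 22
reject   = # 23

-- The labels from scanN to incR read n and r, and those from scanA to incJ a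
-- lower entry.  From letter to refundJ its word is guessed: a zero moves from N
-- to M, and J is subtracted from R by moving it to T and back.  The word ends
-- when N and J are zero, N is restored from M, and the next entry is read, or at
-- the end of the input N and R are compared with zero.  Each entry of the table
-- is followed by its label.
program : Label → Instruction 24 5
program = lookup
  ( (read λ { (just true) → true , incN
            ; (just false) → true , scanR
            ; nothing → false , reject })                             -- scanN
  ∷ (inc N scanN)                                                     -- incN
  ∷ (read λ { (just true) → true , incR
            ; (just false) → true , scanA
            ; nothing → false , reject })                             -- scanR
  ∷ (inc R scanR)                                                     -- incR
  ∷ (read λ { (just true) → true , decN ; _ → false , letter })       -- scanA
  ∷ (dec N reject incJ)                                               -- decN
  ∷ (inc J scanA)                                                     -- incJ
  ∷ (choose one other λ ())                                           -- letter
  ∷ (dec J reject letter)                                             -- one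
  ∷ (dec N done incM)                                                 -- other
  ∷ (inc M pay)                                                       -- incM
  ∷ (dec J refund decR)                                               -- pay
  ∷ (dec R reject incT)                                               -- decR
  ∷ (inc T pay)                                                       -- incT
  ∷ (dec T letter refundJ)                                            -- refund
  ∷ (inc J refund)                                                    -- refundJ
  ∷ (dec J restore reject)                                            -- done
  ∷ (dec M next restoreN)                                             -- restore
  ∷ (inc N restore)                                                   -- restoreN
  ∷ (read λ { (just _) → true , scanA ; nothing → false , finalN })   -- next
  ∷ (dec N finalR reject)                                             -- finalN
  ∷ (dec R accept reject)                                             -- finalR
  ∷ (halt true)                                                       -- accept
  ∷ (halt false)                                                      -- reject
  ∷ [] )

open Program program using (Counts; accepted; rejected; inc; dec₀; dec₊; choose; read)

private variable
  B c : ℕ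
  y   : List Bool

-- The contents of the registers N, R, J, M and T, in this order.
pattern store n r j m t = n ∷ r ∷ j ∷ m ∷ t ∷ []

refund-counts : ∀ {n r m} t j → t + j ≤ B →
  Counts B letter y (store n r (t + j) m 0) c → Counts B refund y (store n r j m t) c
refund-counts zero    j b k = dec₀ refl refl k
refund-counts {B} {y} {c} {n} {r} {m} (suc t) j b k =
  dec₊ refl refl (inc refl (m+n≤o⇒n≤o t (subst (_≤ B) (sym (+-suc t j)) b))
    (refund-counts t (suc j) (subst (_≤ B) (sym (+-suc t j)) b)
      (subst (λ j → Counts B letter y (store n r j m 0) c) (sym (+-suc t j)) k)))

pay-counts : ∀ {n m K} r j t → j + t ≤ B →
  (∀ r → Counts B refund y (store n r 0 m (j + t)) (K r)) →
  Counts B pay y (store n r j m t) (spend j K r)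
pay-counts r       zero    t b k = dec₀ refl refl (k r)
pay-counts zero    (suc j) t b k = dec₊ refl refl (dec₀ refl refl (rejected refl))
pay-counts {B} {y} {n} {m} {K} (suc r) (suc j) t b k =
  dec₊ refl refl (dec₊ refl refl (inc refl (m+n≤o⇒n≤o j b′)
    (pay-counts r j (suc t) b′ λ r →
      subst (λ t → Counts B refund y (store n r 0 m t) (K r)) (sym (+-suc j t)) (k r))))
  where
  b′ : j + suc t ≤ B
  b′ = subst (_≤ B) (sym (+-suc j t)) b

-- Guessing the rest of a word with m zeros still to come and m′ zeros placed.
-- Choosing a one fails when j is zero.  Choosing a zero when m is zero ends the
-- word if j is zero as well and fails otherwise, so that each word is guessed on
-- exactly one path.
letter-counts : ∀ {K} j m m′ r {s} → m + m′ ≡ s → s ≤ B → j ≤ B →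
  (∀ r → Counts B restore y (store 0 r 0 s 0) (K r)) →
  Counts B letter y (store m r j m′ 0) (arrange j m K r)
other-counts : ∀ {K} j m m′ r {s} → suc m + m′ ≡ s → s ≤ B → j ≤ B →
  (∀ r → Counts B restore y (store 0 r 0 s 0) (K r)) →
  Counts B other y (store (suc m) r j m′ 0) (spend j (arrange j m K) r)

letter-counts zero zero m′ r refl _ _ k =
  choose refl (dec₀ refl refl (rejected refl)) (dec₀ refl refl (dec₀ refl refl (k r)))
letter-counts (suc j) zero m′ r e b b′ k =
  subst (Counts _ _ _ _) (+-identityʳ _)
    (choose refl (dec₊ refl refl (letter-counts j zero m′ r e b (<⇒≤ b′) k))
                 (dec₀ refl refl (dec₊ refl refl (rejected refl))))
letter-counts zero (suc m) m′ r e b b′ k =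
  choose refl (dec₀ refl refl (rejected refl)) (other-counts zero m m′ r e b b′ k)
letter-counts (suc j) (suc m) m′ r e b b′ k =
  choose refl (dec₊ refl refl (letter-counts j (suc m) m′ r e b (<⇒≤ b′) k))
              (other-counts (suc j) m m′ r e b b′ k)

other-counts {B} {y} {K} j m m′ r e b b′ k =
  dec₊ refl refl (inc refl (≤-trans (s≤s (m≤n+m m′ m)) (≤-trans (≤-reflexive e) b))
    (pay-counts r j 0 (≤-trans (≤-reflexive (+-identityʳ j)) b′) λ r →
      refund-counts (j + 0) 0 (≤-trans (≤-reflexive j+0+0≡j) b′)
        (subst (λ j′ → Counts B letter y (store m r j′ (suc m′) 0) (arrange j m K r))
          (sym j+0+0≡j)
          (letter-counts j m (suc m′) r (trans (+-suc m m′) e) b b′ k))))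
  where
  j+0+0≡j : j + 0 + 0 ≡ j
  j+0+0≡j = trans (+-identityʳ (j + 0)) (+-identityʳ j)

restore-counts : ∀ {r s} m n → m + n ≡ s → s ≤ B →
  Counts B next y (store s r 0 0 0) c → Counts B restore y (store n r 0 m 0) c
restore-counts zero    n refl b k = dec₀ refl refl k
restore-counts (suc m) n e    b k =
  dec₊ refl refl (inc refl (≤-trans (s≤s (m≤n+m n m)) (≤-trans (≤-reflexive e) b))
    (restore-counts m (suc n) (trans (+-suc m n) e) b k))

block-counts : ∀ {K} j n r → n ≤ B → j ≤ B →
  (∀ r → Counts B next y (store n r 0 0 0) (K r)) →
  Counts B letter y (store n r j 0 0) (arrange j n K r)
block-counts j n r b b′ k =
  letter-counts j n 0 r (+-identityʳ n) b b′ λ r →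
    restore-counts n 0 (+-identityʳ n) b (k r)

final-counts : ∀ n r → Counts B finalN y (store n r 0 0 0) (final n r)
final-counts zero    zero    = dec₀ refl refl (dec₀ refl refl (accepted refl))
final-counts zero    (suc r) = dec₀ refl refl (dec₊ refl refl (rejected refl))
final-counts (suc n) r       = dec₊ refl refl (rejected refl)

blocks-counts : ∀ x n j r → n + j ≤ B →
  Counts B scanA x (store n r j 0 0) (blocks x n j r)
blocks-counts [] n j r b =
  read refl refl (block-counts j n r (m+n≤o⇒m≤o n b) (m+n≤o⇒n≤o n b) λ r →
    read refl refl (final-counts n r))
blocks-counts (false ∷ x) n j r b =
  read refl refl (block-counts j n r (m+n≤o⇒m≤o n b) (m+n≤o⇒n≤o n b) λ r →
    read refl refl (blocks-counts x n 0 r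
      (≤-trans (≤-reflexive (+-identityʳ n)) (m+n≤o⇒m≤o n b))))
blocks-counts (true ∷ x) zero    j r b = read refl refl (dec₀ refl refl (rejected refl))
blocks-counts {B} (true ∷ x) (suc n) j r b =
  read refl refl (dec₊ refl refl (inc refl (m+n≤o⇒n≤o n b′) (blocks-counts x n (suc j) r b′)))
  where
  b′ : n + suc j ≤ B
  b′ = subst (_≤ B) (sym (+-suc n j)) b

second-counts : ∀ x n r → n ≤ B → r + length x ≤ B →
  Counts B scanR x (store n r 0 0 0) (second x n r)
second-counts [] n r b b′ = read refl refl (rejected refl)
second-counts (false ∷ x) n r b b′ =
  read refl refl (blocks-counts x n 0 r (≤-trans (≤-reflexive (+-identityʳ n)) b))
second-counts {B} (true ∷ x) n r b b′ =
  read refl refl (inc refl (m+n≤o⇒m≤o (suc r) b″) (second-counts x n (suc r) b b″))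
  where
  b″ : suc r + length x ≤ B
  b″ = subst (_≤ B) (+-suc r (length x)) b′

first-counts : ∀ x n → n + length x ≤ B → Counts B scanN x (store n 0 0 0 0) (first x n)
first-counts [] n b = read refl refl (rejected refl)
first-counts (false ∷ x) n b =
  read refl refl (second-counts x n 0 (m+n≤o⇒m≤o n b) (<⇒≤ (m+n≤o⇒n≤o n b)))
first-counts {B} (true ∷ x) n b =
  read refl refl (inc refl (m+n≤o⇒m≤o (suc n) b′) (first-counts x (suc n) b′))
  where
  b′ : suc n + length x ≤ B
  b′ = subst (_≤ B) (+-suc n (length x)) b

-- This many binary digits suffice for every register.
n<2^[1+⌊log₂n⌋] : ∀ n → n < 2 ^ suc ⌊log₂ n ⌋
n<2^[1+⌊log₂n⌋] n = ≰⇒> λ p → 1+n≰n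
  (≤-trans (≤-reflexive (sym (⌊log₂[2^n]⌋≡n (suc ⌊log₂ n ⌋)))) (⌊log₂⌋-mono-≤ p))

-- Five tapes with 2 + L cells each, where L = 1 + log n.  The constant term is
-- absorbed because log n is at least 1.
space-bound : ∀ n → 2 ≤ n → 5 * (2 + suc ⌊log₂ n ⌋) ≤ 20 * ⌊log₂ n ⌋
space-bound n 2≤n = begin
  5 * (3 + ⌊log₂ n ⌋)
    ≤⟨ *-monoʳ-≤ 5 (+-monoˡ-≤ ⌊log₂ n ⌋ (*-monoʳ-≤ 3 (⌊log₂⌋-mono-≤ 2≤n))) ⟩
  5 * (3 * ⌊log₂ n ⌋ + ⌊log₂ n ⌋)
    ≡⟨ cong (5 *_) (+-comm (3 * ⌊log₂ n ⌋) ⌊log₂ n ⌋) ⟩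
  5 * (4 * ⌊log₂ n ⌋)
    ≡⟨ *-assoc 5 4 ⌊log₂ n ⌋ ⟨
  20 * ⌊log₂ n ⌋ ∎
  where open ≤-Reasoning

multinomialMachine : Machine
multinomialMachine = Program.machine program scanN

module _ (x : List Bool) where
  open Program.Simulation program scanN x (suc ⌊log₂ length x ⌋) using (S; simulate-initial)
  open Behaviour multinomialMachine x S using (_accepts_) public

  machine-accepts : Run.initial multinomialMachine x accepts count x
  machine-accepts =
    simulate-initial refl (n<2^[1+⌊log₂n⌋] (length x)) (first-counts x 0 ≤-refl)

corollary5p5 : ∃ λ f → IsQMultinomialCoeff f × f ∈#L
corollary5p5 = count , count-isQMultinomialCoeff , multinomialMachine ,
  (20 , 2 , λ x 2≤n run →
    ≤-trans (_accepts_.small (machine-accepts x) run) (space-bound (length x) 2≤n)) ,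
  (λ x → _accepts_.halts (machine-accepts x)) ,
  (λ x → _accepts_.paths (machine-accepts x))
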